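{- No random online function $F:2^\omega\to 2^\omega$ is onto; that is, for every random online function $F$, $\mathrm{ran}(F)\neq 2^\omega$.
   Context: $2^{<\omega}$ is the set of finite binary strings, $\epsilon$ the empty string, and $y\upharpoonright n=(y(0),\dots,y(n-1))$. Let $\sigma_0=\epsilon,\sigma_1,\sigma_2,\dots$ list $2^{<\omega}$ in length-lexicographic order. Each $x\in 2^\omega$ codes the representing function $f_x:2^{<\omega}\setminus\{\epsilon\}\to\{0,1\}$ given by $f_x(\sigma_{n+1})=x(n)$ for all $n$, and the online function $F_x:2^\omega\to 2^\omega$ given by $F_x(y)=f_x(y\upharpoonright 1)\,f_x(y\upharpoonright 2)\,f_x(y\upharpoonright 3)\cdots$, i.e. $F_x(y)(n)=f_x(y\upharpoonright (n+1))$. A function $F$ is a random online function if $F=F_x$ for some $x\in 2^\omega$ that is Martin-Löf random with respect to the uniform measure on $2^\omega$. -}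

module Defs where

open import Data.Bool using (Bool; true; false)
import Data.Bool as Bool
open import Data.Fin using (Fin)
open import Data.Integer using (+_)
open import Data.List using (List; []; _∷_; _++_; length; map; filter; foldl; foldr; reverse; applyUpTo)
open import Data.List.Extrema.Nat using (max)
open import Data.List.Properties using (reverse-foldl)
open import Data.List.Relation.Binary.Lex.Strict using (Lex-<; base; halt; this; next)
open import Data.List.Relation.Binary.Prefix.Heterogeneous using (Prefix)
open import Data.List.Relation.Binary.Prefix.Heterogeneous.Properties using (prefix?)
open import Data.List.Relation.Unary.All using (All)
open import Data.List.Relation.Unary.Any using (any?)
open import Data.Nat using (ℕ; zero; suc; pred; _+_; _*_; _^_; _≤_; _<_; s≤s; z≤n)
open import Data.Nat.Properties
open import Data.Nat.Tactic.RingSolver using (solve-∀)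
open import Data.Product using (∃; ∃-syntax; _×_; _,_)
open import Data.Rational.Unnormalised using (ℚᵘ; _/_) renaming (_≤_ to _≤ℚ_)
open import Data.Vec using (Vec; []; _∷_; lookup)
open import Data.Vec.Relation.Binary.Pointwise.Inductive using (Pointwise)
open import Function using (flip)
open import Function.Bundles using (_⇔_)
open import Level using (0ℓ)
open import Relation.Binary.PropositionalEquality using (_≡_; _≗_; refl; sym; trans; cong)
open import Relation.Nullary using (¬_)
open import Relation.Unary using (Pred; _∈_)

------------------------------------------------------------------------
-- Strings and sequences

Str : Set
Str = List Bool

-- Elements of Cantor space are compared with _≗_, not _≡_, since function
-- extensionality is not available.
Cantor : Set
Cantor = ℕ → Bool

infix 8 _↾_

_↾_ : Cantor → ℕ → Str
y ↾ n = applyUpTo y n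

------------------------------------------------------------------------
-- The length-lexicographic listing of strings

data _<ₗₗ_ (s t : Str) : Set where
  shorter : length s < length t → s <ₗₗ t
  lex     : length s ≡ length t → Lex-< _≡_ Bool._<_ s t → s <ₗₗ t

bit : Bool → ℕ
bit false = 0
bit true  = 1

-- The position of a string in the listing: prefixing s with the digit 1
-- gives the binary expansion of suc (index s).  That this is the position
-- in the order _<ₗₗ_ is the content of index-mono and index-σ below.
step : ℕ → Bool → ℕ
step i b = suc (bit b + 2 * i)

index : Str → ℕ
index = foldl step 0

-- The immediate successor, on strings written last bit first.
nextʳ : Str → Str
nextʳ []          = false ∷ []
nextʳ (false ∷ r) = true ∷ r
nextʳ (true ∷ r)  = false ∷ nextʳ r

σʳ : ℕ → Str
σʳ zero    = []
σʳ (suc n) = nextʳ (σʳ n)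

σ : ℕ → Str
σ n = reverse (σʳ n)

private
  indexʳ : Str → ℕ
  indexʳ = foldr (flip step) 0

  indexʳ-next : ∀ r → indexʳ (nextʳ r) ≡ suc (indexʳ r)
  indexʳ-next []          = refl
  indexʳ-next (false ∷ r) = refl
  indexʳ-next (true ∷ r)  =
    trans (cong (λ k → suc (2 * k)) (indexʳ-next r)) (double (indexʳ r))
    where
    double : ∀ k → suc (2 * suc k) ≡ suc (suc (suc (2 * k)))
    double = solve-∀

  indexʳ-σʳ : ∀ n → indexʳ (σʳ n) ≡ n
  indexʳ-σʳ zero    = refl
  indexʳ-σʳ (suc n) = trans (indexʳ-next (σʳ n)) (cong suc (indexʳ-σʳ n))

index-σ : ∀ n → index (σ n) ≡ n
index-σ n = trans (reverse-foldl step 0 (σʳ n)) (indexʳ-σʳ n)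

private
  bit≤1 : ∀ b → bit b ≤ 1
  bit≤1 false = z≤n
  bit≤1 true  = s≤s z≤n

  step-< : ∀ {i j} b c → i < j → step i b < step j c
  step-< {i} {j} b c i<j = s≤s (begin
    suc (bit b + 2 * i)  ≤⟨ s≤s (+-monoˡ-≤ (2 * i) (bit≤1 b)) ⟩
    2 + 2 * i            ≡⟨ sym (*-suc 2 i) ⟩
    2 * suc i            ≤⟨ *-monoʳ-≤ 2 i<j ⟩
    2 * j                ≤⟨ m≤n+m (2 * j) (bit c) ⟩
    bit c + 2 * j        ∎)
    where open ≤-Reasoning

  fold-< : ∀ {i j} s t → length s ≡ length t → i < j → foldl step i s < foldl step j t
  fold-< []      []      _  i<j = i<j
  fold-< (b ∷ s) (c ∷ t) eq i<j = fold-< s t (suc-injective eq) (step-< b c i<j)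

  fold-lex : ∀ {i s t} → length s ≡ length t → Lex-< _≡_ Bool._<_ s t →
             foldl step i s < foldl step i t
  fold-lex _  (base ())
  fold-lex () halt
  fold-lex {s = _ ∷ s} {_ ∷ t} eq (this Bool.f<t) = fold-< s t (suc-injective eq) ≤-refl
  fold-lex eq (next refl s<t) = fold-lex (suc-injective eq) s<t

  fold-lower : ∀ i s → suc i * 2 ^ length s ≤ suc (foldl step i s)
  fold-lower i []      = ≤-reflexive (*-identityʳ (suc i))
  fold-lower i (b ∷ s) = begin
    suc i * (2 * 2 ^ length s)         ≡⟨ regroup i (2 ^ length s) ⟩
    suc (suc (2 * i)) * 2 ^ length s   ≤⟨ *-monoˡ-≤ (2 ^ length s) (s≤s (s≤s (m≤n+m (2 * i) (bit b)))) ⟩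
    suc (step i b) * 2 ^ length s      ≤⟨ fold-lower (step i b) s ⟩
    suc (foldl step (step i b) s)      ∎
    where
    open ≤-Reasoning
    regroup : ∀ i p → suc i * (2 * p) ≡ suc (suc (2 * i)) * p
    regroup = solve-∀

  fold-upper : ∀ i s → suc (suc (foldl step i s)) ≤ (2 + i) * 2 ^ length s
  fold-upper i []      = ≤-reflexive (sym (*-identityʳ (2 + i)))
  fold-upper i (b ∷ s) = begin
    suc (suc (foldl step (step i b) s))  ≤⟨ fold-upper (step i b) s ⟩
    (2 + step i b) * 2 ^ length s        ≤⟨ *-monoˡ-≤ (2 ^ length s) (+-monoʳ-≤ 3 (+-monoˡ-≤ (2 * i) (bit≤1 b))) ⟩
    (4 + 2 * i) * 2 ^ length s           ≡⟨ regroup i (2 ^ length s) ⟩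
    (2 + i) * (2 * 2 ^ length s)         ∎
    where
    open ≤-Reasoning
    regroup : ∀ i p → (4 + 2 * i) * p ≡ (2 + i) * (2 * p)
    regroup = solve-∀

index-mono : ∀ {s t} → s <ₗₗ t → index s < index t
index-mono {s} {t} (shorter s<t) = ≤-pred (begin
  suc (suc (index s))  ≤⟨ fold-upper 0 s ⟩
  2 ^ suc (length s)   ≤⟨ ^-monoʳ-≤ 2 s<t ⟩
  2 ^ length t         ≡⟨ sym (*-identityˡ (2 ^ length t)) ⟩
  1 * 2 ^ length t     ≤⟨ fold-lower 0 t ⟩
  suc (index t)        ∎)
  where open ≤-Reasoning
index-mono (lex eq s<t) = fold-lex eq s<t

------------------------------------------------------------------------
-- Online functions

-- Only meaningful on nonempty strings; the value at [] is a dummy.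
representing : Cantor → Str → Bool
representing x s = x (pred (index s))

representing-σ : ∀ x n → representing x (σ (suc n)) ≡ x n
representing-σ x n = cong (λ k → x (pred k)) (index-σ (suc n))

online : Cantor → Cantor → Cantor
online x y n = representing x (y ↾ suc n)

------------------------------------------------------------------------
-- Partial recursive functions and computable enumerability

data PartRec : ℕ → Set where
  zeroᵖ : ∀ {n} → PartRec n
  sucᵖ  : PartRec 1
  proj  : ∀ {n} → Fin n → PartRec n
  comp  : ∀ {m n} → PartRec m → Vec (PartRec n) m → PartRec n
  prim  : ∀ {n} → PartRec n → PartRec (2 + n) → PartRec (1 + n)
  mini  : ∀ {n} → PartRec (1 + n) → PartRec n

infix 4 _[_]⇓_ _[_]↓

-- f [ xs ]⇓ y : the computation of f on input xs halts with output y.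
data _[_]⇓_ : ∀ {n} → PartRec n → Vec ℕ n → ℕ → Set where
  zero⇓ : ∀ {n} {xs : Vec ℕ n} → zeroᵖ [ xs ]⇓ 0
  suc⇓  : ∀ {x} → sucᵖ [ x ∷ [] ]⇓ suc x
  proj⇓ : ∀ {n} {xs : Vec ℕ n} {i} → proj i [ xs ]⇓ lookup xs i
  comp⇓ : ∀ {m n} {f : PartRec m} {gs : Vec (PartRec n) m} {xs ys z} →
          Pointwise (λ g y → g [ xs ]⇓ y) gs ys →
          f [ ys ]⇓ z →
          comp f gs [ xs ]⇓ z
  prim-zero⇓ : ∀ {n} {f : PartRec n} {g xs z} →
               f [ xs ]⇓ z →
               prim f g [ 0 ∷ xs ]⇓ z
  prim-suc⇓  : ∀ {n} {f : PartRec n} {g k xs y z} →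
               prim f g [ k ∷ xs ]⇓ y →
               g [ k ∷ y ∷ xs ]⇓ z →
               prim f g [ suc k ∷ xs ]⇓ z
  mini⇓ : ∀ {n} {f : PartRec (1 + n)} {xs k} →
          (∀ j → j < k → ∃[ v ] f [ j ∷ xs ]⇓ suc v) →
          f [ k ∷ xs ]⇓ 0 →
          mini f [ xs ]⇓ k

_[_]↓ : ∀ {n} → PartRec n → Vec ℕ n → Set
f [ xs ]↓ = ∃[ y ] f [ xs ]⇓ y

UniformlyCE : (ℕ → Pred Str 0ℓ) → Set
UniformlyCE W = ∃[ p ] (∀ n s → s ∈ W n ⇔ p [ n ∷ index s ∷ [] ]↓)

------------------------------------------------------------------------
-- Open sets and the uniform measure

-- The open set generated by W: all sequences with an initial segment in W.
⟦_⟧ : Pred Str 0ℓ → Pred Cantor 0ℓ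
⟦ W ⟧ x = ∃[ m ] (x ↾ m ∈ W)

strings : ℕ → List Str
strings zero    = [] ∷ []
strings (suc n) = map (false ∷_) (strings n) ++ map (true ∷_) (strings n)

_/2^_ : ℕ → ℕ → ℚᵘ
a /2^ n = _/_ (+ a) (2 ^ n) {{m^n≢0 2 n}}

-- The measure of the union of the cylinders of the strings in ss: if no
-- member of ss is longer than L, that union is a disjoint union of cylinders
-- of strings of length L, each of measure 2^-L.
measure : List Str → ℚᵘ
measure ss = length (filter (λ t → any? (λ s → prefix? Bool._≟_ s t) ss) (strings L)) /2^ L
  where
  L : ℕ
  L = max 0 (map length ss)

-- The measure of ⟦ W ⟧ is the supremum of the measures of the finite unions
-- of cylinders given by strings in W, so this says it is at most q.
MeasureAtMost : Pred Str 0ℓ → ℚᵘ → Set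
MeasureAtMost W q = ∀ ss → All W ss → measure ss ≤ℚ q

------------------------------------------------------------------------
-- Martin-Löf randomness

record MLTest (W : ℕ → Pred Str 0ℓ) : Set where
  field
    uniformlyCE : UniformlyCE W
    small       : ∀ n → MeasureAtMost (W n) (1 /2^ n)

MLRandom : Cantor → Set₁
MLRandom x = ∀ W → MLTest W → ¬ (∀ n → x ∈ ⟦ W n ⟧)

RandomOnline : (Cantor → Cantor) → Set₁
RandomOnline F = ∃[ x ] (MLRandom x × (∀ y → F y ≗ online x y))

{-# OPTIONS --safe #-}

-- If F_x is onto then, level by level, the map y ↾ n ↦ F_x(y) ↾ n is
-- injective: if the two children of a node carried the same label, the other
-- label could not follow the image of that node.  The children of the i-th
-- node carry the labels x(2i) and x(2i+1), so x(2i) ≠ x(2i+1) for all i.  The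
-- strings made of n pairs of different bits form a Martin-Löf test capturing
-- every such x, the n-th open set having measure 2⁻ⁿ.

module Submission where

open import Defs
open import Data.Bool using (Bool; true; false; not; if_then_else_)
open import Data.Bool.Properties using (not-¬; ¬-not)
import Data.Bool as Bool
open import Data.Fin using (zero; suc)
open import Data.Integer as ℤ using (+_)
import Data.Integer.Properties as ℤ
open import Data.List using ([]; _∷_; _++_; _∷ʳ_; length; map; filter; foldl; foldr; reverse)
open import Data.List.Extrema.Nat using (max)
open import Data.List.Properties
  using (length-++; length-map; length-filter; filter-++; filter-none; foldl-∷ʳ; applyUpTo-∷ʳ;
         reverse-foldr; reverse-injective)
open import Data.List.Relation.Binary.Prefix.Heterogeneous using (Prefix; []; _∷_)
open import Data.List.Relation.Binary.Prefix.Heterogeneous.Properties using (prefix?)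
open import Data.List.Relation.Unary.All as All using (All; []; _∷_)
open import Data.List.Relation.Unary.Any as Any using (Any; any?)
open import Data.Nat using (ℕ; zero; suc; pred; _+_; _*_; _∸_; _^_; _≤_; _<_; _<ᵇ_; z≤n)
open import Data.Nat.Properties
open import Data.Nat.Tactic.RingSolver using (solve-∀)
open import Data.Product using (∃-syntax; _×_; _,_; proj₁; proj₂)
open import Data.Rational.Unnormalised using (*≤*) renaming (_≤_ to _≤ℚ_)
open import Data.Rational.Unnormalised.Properties using (↥[n/d]≡n; ↧[n/d]≡d)
open import Data.Sum using (inj₁; inj₂)
open import Data.Vec using (Vec; []; _∷_)
open import Data.Vec.Relation.Binary.Pointwise.Inductive using (Pointwise; []; _∷_)
open import Function using (_∘_; flip; mk⇔)
open import Function.Definitions using (StrictlySurjective)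
open import Level using (0ℓ)
open import Relation.Binary.Definitions using (tri<; tri≈; tri>)
open import Relation.Binary.PropositionalEquality
open import Relation.Nullary using (¬_; yes; no; contradiction)
open import Relation.Unary using (Pred; Decidable; _∈_)

-- Surjective online functions

index-∷ʳ : ∀ y n → index (y ↾ suc n) ≡ step (index (y ↾ n)) (y n)
index-∷ʳ y n = trans (cong index (sym (applyUpTo-∷ʳ y n))) (foldl-∷ʳ step 0 (y n) (y ↾ n))

-- The `pred` in `representing` cancels the `suc` in `step`, so the children of the node with index
-- `i` read bits `2 * i` and `1 + 2 * i` of `x`.
online-label : ∀ x y n → online x y n ≡ x (bit (y n) + 2 * index (y ↾ n))
online-label x y n = cong (x ∘ pred) (index-∷ʳ y n)

pad : Str → Cantor
pad []      _       = false
pad (b ∷ s) zero    = b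
pad (b ∷ s) (suc k) = pad s k

pad-↾ : ∀ s → pad s ↾ length s ≡ s
pad-↾ []      = refl
pad-↾ (b ∷ s) = cong (b ∷_) (pad-↾ s)

replaceAt : ℕ → Bool → Cantor → Cantor
replaceAt n b z k = if k <ᵇ n then z k else b

replaceAt-< : ∀ {n k} b z → k < n → replaceAt n b z k ≡ z k
replaceAt-< {n} {k} b z k<n with k <ᵇ n | <⇒<ᵇ k<n
... | true | _ = refl

replaceAt-≡ : ∀ n b z → replaceAt n b z n ≡ b
replaceAt-≡ zero    b z = refl
replaceAt-≡ (suc n) b z = replaceAt-≡ n b (z ∘ suc)

AlternatingPairs : Pred Cantor 0ℓ
AlternatingPairs x = ∀ i → x (1 + 2 * i) ≡ not (x (2 * i))

module _ (x : Cantor) (onto : StrictlySurjective _≗_ (online x)) where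

  InjectiveUpTo : ℕ → Set
  InjectiveUpTo n = ∀ y y′ → (∀ k → k < n → online x y k ≡ online x y′ k) →
                    index (y ↾ n) ≡ index (y′ ↾ n)

  -- If both children of the node carried one label, a preimage of the sequence `z`, which copies
  -- the image of `y` below `n` and takes the other label at `n`, would by injectivity pass through
  -- that same node and could not produce this label.
  siblings : ∀ n → InjectiveUpTo n → ∀ y →
             x (1 + 2 * index (y ↾ n)) ≢ x (2 * index (y ↾ n))
  siblings n inj y same = not-¬ {x (2 * i)} refl (begin
    x (2 * i)                              ≡⟨ label (y′ n) ⟨
    x (bit (y′ n) + 2 * i)                 ≡⟨ cong (λ j → x (bit (y′ n) + 2 * j)) i≡ ⟩
    x (bit (y′ n) + 2 * index (y′ ↾ n))    ≡⟨ online-label x y′ n ⟨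
    online x y′ n                          ≡⟨ hit n ⟩
    z n                                    ≡⟨ replaceAt-≡ n _ (online x y) ⟩
    not (x (2 * i))                        ∎)
    where
    open ≡-Reasoning
    i  = index (y ↾ n)
    z  = replaceAt n (not (x (2 * i))) (online x y)
    y′ = proj₁ (onto z)
    hit = proj₂ (onto z)
    i≡ : i ≡ index (y′ ↾ n)
    i≡ = inj y y′ λ k k<n → sym (trans (hit k) (replaceAt-< _ (online x y) k<n))
    label : ∀ b → x (bit b + 2 * i) ≡ x (2 * i)
    label false = refl
    label true  = same

  -- Induction on the level: equal earlier labels lead to the same node, and `siblings` at level
  -- `n`, which rests only on injectivity at `n`, makes the next label determine the next bit.
  injective : ∀ n → InjectiveUpTo n
  injective zero    y y′ agree = refl
  injective (suc n) y y′ agree = begin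
    index (y ↾ suc n)            ≡⟨ index-∷ʳ y n ⟩
    step (index (y ↾ n)) (y n)   ≡⟨ cong₂ step i≡ (bits (y n) (y′ n) labels) ⟩
    step (index (y′ ↾ n)) (y′ n) ≡⟨ index-∷ʳ y′ n ⟨
    index (y′ ↾ suc n)           ∎
    where
    open ≡-Reasoning
    i = index (y ↾ n)
    i≡ : i ≡ index (y′ ↾ n)
    i≡ = injective n y y′ λ k k<n → agree k (m<n⇒m<1+n k<n)
    labels : x (bit (y n) + 2 * i) ≡ x (bit (y′ n) + 2 * i)
    labels = begin
      x (bit (y n) + 2 * i)                ≡⟨ online-label x y n ⟨
      online x y n                         ≡⟨ agree n ≤-refl ⟩
      online x y′ n                        ≡⟨ online-label x y′ n ⟩
      x (bit (y′ n) + 2 * index (y′ ↾ n))  ≡⟨ cong (λ j → x (bit (y′ n) + 2 * j)) i≡ ⟨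
      x (bit (y′ n) + 2 * i)               ∎
    bits : ∀ b c → x (bit b + 2 * i) ≡ x (bit c + 2 * i) → b ≡ c
    bits false false _  = refl
    bits true  true  _  = refl
    bits false true  eq = contradiction (sym eq) (siblings n (injective n) y)
    bits true  false eq = contradiction eq (siblings n (injective n) y)

  onto⇒alternatingPairs : AlternatingPairs x
  onto⇒alternatingPairs i =
    -- Every `i` is the index of a node, namely `σ i`; padding makes that node an initial segment of
    -- a sequence.
    subst (λ j → x (1 + 2 * j) ≡ not (x (2 * j))) (trans (cong index (pad-↾ (σ i))) (index-σ i))
      (¬-not (siblings (length (σ i)) (injective (length (σ i))) (pad (σ i))))

-- The Martin-Löf test

data Pairs : ℕ → Pred Str 0ℓ where
  []   : Pairs 0 []
  pair : ∀ {n s} b → Pairs n s → Pairs (suc n) (b ∷ not b ∷ s)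

alternatingPairs⇒Pairs : ∀ x → AlternatingPairs x → ∀ n → x ↾ (n * 2) ∈ Pairs n
alternatingPairs⇒Pairs x alt zero    = []
-- The rewrite turns the second bit `x 1` into `not (x 0)`, the shape that `pair` requires.
alternatingPairs⇒Pairs x alt (suc n) rewrite alt 0 =
  pair (x 0) (alternatingPairs⇒Pairs (λ k → x (2 + k))
    (λ i → subst (λ j → x (1 + j) ≡ not (x j)) (*-suc 2 i) (alt (suc i))) n)

-- Counting strings and the measure of the test

length-filter-map : ∀ {A B : Set} {P : Pred B 0ℓ} (P? : Decidable P) (f : A → B) xs →
                    length (filter P? (map f xs)) ≡ length (filter (P? ∘ f) xs)
length-filter-map P? f []       = refl
length-filter-map P? f (a ∷ xs) with P? (f a)
... | yes _ = cong suc (length-filter-map P? f xs)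
... | no  _ = length-filter-map P? f xs

count : ∀ {P : Pred Str 0ℓ} → Decidable P → ℕ → ℕ
count P? L = length (filter P? (strings L))

count-suc : ∀ {P : Pred Str 0ℓ} (P? : Decidable P) L →
            count P? (suc L) ≡ count (P? ∘ (false ∷_)) L + count (P? ∘ (true ∷_)) L
count-suc P? L = begin
  length (filter P? (F ++ T))                     ≡⟨ cong length (filter-++ P? F T) ⟩
  length (filter P? F ++ filter P? T)             ≡⟨ length-++ (filter P? F) ⟩
  length (filter P? F) + length (filter P? T)     ≡⟨ cong₂ _+_ (length-filter-map P? _ (strings L))
                                                               (length-filter-map P? _ (strings L)) ⟩
  count (P? ∘ (false ∷_)) L + count (P? ∘ (true ∷_)) L ∎
  where
  open ≡-Reasoning
  F = map (false ∷_) (strings L)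
  T = map (true ∷_) (strings L)

count-none : ∀ {P : Pred Str 0ℓ} (P? : Decidable P) L → (∀ s → ¬ P s) → count P? L ≡ 0
count-none P? L none = cong length (filter-none P? (All.universal none (strings L)))

length-strings : ∀ L → length (strings L) ≡ 2 ^ L
length-strings zero    = refl
length-strings (suc L) = begin
  length (map (false ∷_) (strings L) ++ map (true ∷_) (strings L))
    ≡⟨ length-++ (map (false ∷_) (strings L)) ⟩
  length (map (false ∷_) (strings L)) + length (map (true ∷_) (strings L))
    ≡⟨ cong₂ _+_ (half false) (trans (half true) (sym (+-identityʳ _))) ⟩
  2 ^ suc L ∎
  where
  open ≡-Reasoning
  half : ∀ b → length (map (b ∷_) (strings L)) ≡ 2 ^ L
  half b = trans (length-map (b ∷_) (strings L)) (length-strings L)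

ExtendsPairs : ℕ → Pred Str 0ℓ
ExtendsPairs n t = ∃[ s ] (Pairs n s × Prefix _≡_ s t)

tail-ExtendsPairs : ∀ {n b c t} → ExtendsPairs (suc n) (b ∷ c ∷ t) → ExtendsPairs n t
tail-ExtendsPairs (_ , pair b ps , refl ∷ refl ∷ pre) = _ , ps , pre

¬ExtendsPairs-[] : ∀ {n} → ¬ ExtendsPairs (suc n) []
¬ExtendsPairs-[] (_ , pair _ _ , ())

¬ExtendsPairs-[-] : ∀ {n b} → ¬ ExtendsPairs (suc n) (b ∷ [])
¬ExtendsPairs-[-] (_ , pair _ _ , _ ∷ ())

¬ExtendsPairs-equal : ∀ {n} b {t} → ¬ ExtendsPairs (suc n) (b ∷ b ∷ t)
¬ExtendsPairs-equal false (_ , pair .false _ , refl ∷ () ∷ _)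
¬ExtendsPairs-equal true  (_ , pair .true  _ , refl ∷ () ∷ _)

-- Of the four choices for the first two bits only the two unequal ones survive, so each pair costs
-- a factor of one half. Taking any `P` that implies `ExtendsPairs n` lets the induction pass to `P`
-- after a fixed pair.
count-ExtendsPairs : ∀ n L {P : Pred Str 0ℓ} (P? : Decidable P) →
                     (∀ t → P t → ExtendsPairs n t) → count P? L * 2 ^ n ≤ 2 ^ L
count-ExtendsPairs zero L P? ext = begin
  count P? L * 1       ≡⟨ *-identityʳ _ ⟩
  count P? L           ≤⟨ length-filter P? (strings L) ⟩
  length (strings L)   ≡⟨ length-strings L ⟩
  2 ^ L                ∎
  where open ≤-Reasoning
-- For `L` equal to 0 or 1 the first pair does not fit, so the count is 0.
count-ExtendsPairs (suc n) zero P? ext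
  rewrite filter-none P? {[] ∷ []} ((λ p → ¬ExtendsPairs-[] (ext _ p)) ∷ []) = z≤n
count-ExtendsPairs (suc n) (suc zero) P? ext
  rewrite filter-none P? {(false ∷ []) ∷ (true ∷ []) ∷ []}
    ((λ p → ¬ExtendsPairs-[-] (ext _ p)) ∷ (λ p → ¬ExtendsPairs-[-] (ext _ p)) ∷ []) = z≤n
count-ExtendsPairs (suc n) (suc (suc L)) P? ext = begin
  count P? (2 + L) * 2 ^ suc n              ≡⟨ cong (_* 2 ^ suc n) split ⟩
  (cnt false + cnt true) * (2 * 2 ^ n)      ≡⟨ regroup (cnt false) (cnt true) (2 ^ n) ⟩
  2 * (cnt false * 2 ^ n + cnt true * 2 ^ n)  ≤⟨ *-monoʳ-≤ 2 (+-mono-≤ (ih false) (ih true)) ⟩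
  2 * (2 ^ L + 2 ^ L)                       ≡⟨ cong (λ k → 2 * (2 ^ L + k)) (sym (+-identityʳ (2 ^ L))) ⟩
  2 ^ (2 + L)                               ∎
  where
  open ≤-Reasoning
  cnt : Bool → ℕ
  cnt b = count (P? ∘ (b ∷_) ∘ (not b ∷_)) L
  ih : ∀ b → cnt b * 2 ^ n ≤ 2 ^ L
  ih b = count-ExtendsPairs n L (P? ∘ (b ∷_) ∘ (not b ∷_)) (λ t p → tail-ExtendsPairs (ext _ p))
  equal-none : ∀ b → count (P? ∘ (b ∷_) ∘ (b ∷_)) L ≡ 0
  equal-none b = count-none (P? ∘ (b ∷_) ∘ (b ∷_)) L (λ t p → ¬ExtendsPairs-equal b (ext _ p))
  split : count P? (2 + L) ≡ cnt false + cnt true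
  split = trans (count-suc P? (suc L)) (cong₂ _+_
    (trans (count-suc (P? ∘ (false ∷_)) L) (cong (_+ cnt false) (equal-none false)))
    (trans (count-suc (P? ∘ (true ∷_)) L)
           (trans (cong (_+_ (cnt true)) (equal-none true)) (+-identityʳ (cnt true)))))
  regroup : ∀ a b p → (a + b) * (2 * p) ≡ 2 * (a * p + b * p)
  regroup = solve-∀

-- The order on unnormalised fractions is cross multiplication; the numerator and denominator lemmas
-- are used because `_/_` does not reduce at an open power of 2.
/2^-mono : ∀ a m b n → a * 2 ^ n ≤ b * 2 ^ m → (a /2^ m) ≤ℚ (b /2^ n)
/2^-mono a m b n le = *≤* (subst₂ ℤ._≤_
  (sym (trans (cong₂ ℤ._*_ (↥[n/d]≡n (+ a) (2 ^ m)) (↧[n/d]≡d (+ b) (2 ^ n))) (sym (ℤ.pos-* a (2 ^ n)))))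
  (sym (trans (cong₂ ℤ._*_ (↥[n/d]≡n (+ b) (2 ^ n)) (↧[n/d]≡d (+ a) (2 ^ m))) (sym (ℤ.pos-* b (2 ^ m)))))
  (ℤ.+≤+ le))
  where instance
    _ = m^n≢0 2 m
    _ = m^n≢0 2 n

Pairs-small : ∀ n → MeasureAtMost (Pairs n) (1 /2^ n)
Pairs-small n ss all = /2^-mono (count P? L) L 1 n
  (subst (count P? L * 2 ^ n ≤_) (sym (*-identityˡ (2 ^ L)))
    -- A counted string has a prefix in `ss`, and `all` puts that prefix in `Pairs n`.
    (count-ExtendsPairs n L P? λ t any → Any.lookup any , All.lookupAny all any))
  where
  L = max 0 (map length ss)
  P? : Decidable (λ t → Any (λ s → Prefix _≡_ s t) ss)
  P? t = any? (λ s → prefix? Bool._≟_ s t) ss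

-- Computable enumerability of the test

mutual
  -- Used to read off the value of `mismatch` from a halting run of `unpairᵖ`.
  ⇓-deterministic : ∀ {n} {f : PartRec n} {xs y z} → f [ xs ]⇓ y → f [ xs ]⇓ z → y ≡ z
  ⇓-deterministic zero⇓ zero⇓ = refl
  ⇓-deterministic suc⇓  suc⇓  = refl
  ⇓-deterministic proj⇓ proj⇓ = refl
  ⇓-deterministic (comp⇓ gs f) (comp⇓ gs′ f′) with ⇓-deterministic* gs gs′
  ... | refl = ⇓-deterministic f f′
  ⇓-deterministic (prim-zero⇓ f) (prim-zero⇓ f′) = ⇓-deterministic f f′
  ⇓-deterministic (prim-suc⇓ r g) (prim-suc⇓ r′ g′) with ⇓-deterministic r r′
  ... | refl = ⇓-deterministic g g′
  ⇓-deterministic (mini⇓ {k = k} below f) (mini⇓ {k = k′} below′ f′) with <-cmp k k′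
  ... | tri≈ _ k≡k′ _ = k≡k′
  -- The smaller of two different results would give both 0 and a successor as the value of `f`.
  ... | tri< k<k′ _ _ = contradiction (⇓-deterministic f (proj₂ (below′ k k<k′))) 0≢1+n
  ... | tri> _ _ k′<k = contradiction (sym (⇓-deterministic (proj₂ (below k′ k′<k)) f′)) 0≢1+n

  ⇓-deterministic* : ∀ {m n} {gs : Vec (PartRec n) m} {xs ys zs} →
                     Pointwise (λ g y → g [ xs ]⇓ y) gs ys →
                     Pointwise (λ g z → g [ xs ]⇓ z) gs zs → ys ≡ zs
  ⇓-deterministic* []       []         = refl
  ⇓-deterministic* (g ∷ gs) (g′ ∷ gs′) = cong₂ _∷_ (⇓-deterministic g g′) (⇓-deterministic* gs gs′)

-- Arithmetic programs

addᵖ : PartRec 2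
addᵖ = prim (proj zero) (comp sucᵖ (proj (suc zero) ∷ []))

addᵖ⇓ : ∀ m n → addᵖ [ m ∷ n ∷ [] ]⇓ (m + n)
addᵖ⇓ zero    n = prim-zero⇓ proj⇓
addᵖ⇓ (suc m) n = prim-suc⇓ (addᵖ⇓ m n) (comp⇓ (proj⇓ ∷ []) suc⇓)

predᵖ : PartRec 1
predᵖ = prim zeroᵖ (proj zero)

predᵖ⇓ : ∀ n → predᵖ [ n ∷ [] ]⇓ pred n
predᵖ⇓ zero    = prim-zero⇓ zero⇓
predᵖ⇓ (suc n) = prim-suc⇓ (predᵖ⇓ n) proj⇓

-- The subtrahend comes first, since prim recurses on the first argument.
monusᵖ : PartRec 2
monusᵖ = prim (proj zero) (comp predᵖ (proj (suc zero) ∷ []))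

monusᵖ⇓ : ∀ n m → monusᵖ [ n ∷ m ∷ [] ]⇓ (m ∸ n)
monusᵖ⇓ zero    m = prim-zero⇓ proj⇓
monusᵖ⇓ (suc n) m = subst (monusᵖ [ suc n ∷ m ∷ [] ]⇓_) (pred[m∸n]≡m∸[1+n] m n)
  (prim-suc⇓ (monusᵖ⇓ n m) (comp⇓ (proj⇓ ∷ []) (predᵖ⇓ (m ∸ n))))

-- Computes `n + (n + 0)`, the form to which `2 * n` unfolds.
doubleᵖ : PartRec 1
doubleᵖ = comp addᵖ (proj zero ∷ comp addᵖ (proj zero ∷ zeroᵖ ∷ []) ∷ [])

doubleᵖ⇓ : ∀ n → doubleᵖ [ n ∷ [] ]⇓ (2 * n)
doubleᵖ⇓ n = comp⇓ (proj⇓ ∷ comp⇓ (proj⇓ ∷ zero⇓ ∷ []) (addᵖ⇓ n 0) ∷ []) (addᵖ⇓ n (n + 0))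

stepᵖ : Bool → PartRec 1
stepᵖ false = comp sucᵖ (doubleᵖ ∷ [])
stepᵖ true  = comp sucᵖ (stepᵖ false ∷ [])

stepᵖ⇓ : ∀ b i → stepᵖ b [ i ∷ [] ]⇓ step i b
stepᵖ⇓ false i = comp⇓ (doubleᵖ⇓ i ∷ []) suc⇓
stepᵖ⇓ true  i = comp⇓ (stepᵖ⇓ false i ∷ []) suc⇓

-- Decoding pairs from indices

-- The effect on the index of appending a pair of different bits: `4 * i + 4` for `false`,
-- `4 * i + 5` for `true`.
stepPair : ℕ → Bool → ℕ
stepPair i b = step (step i b) (not b)

stepPairᵖ : Bool → PartRec 2
stepPairᵖ b = comp (stepᵖ (not b)) (comp (stepᵖ b) (proj zero ∷ []) ∷ [])

stepPairᵖ⇓ : ∀ b i j → stepPairᵖ b [ i ∷ j ∷ [] ]⇓ stepPair i b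
stepPairᵖ⇓ b i j = comp⇓ (comp⇓ (proj⇓ ∷ []) (stepᵖ⇓ b i) ∷ []) (stepᵖ⇓ (not b) (step i b))

stepPair-suc : ∀ i → stepPair i true ≡ suc (stepPair i false)
stepPair-suc i = cong suc (*-suc 2 (suc (2 * i)))

-- Vanishes exactly when stepPair i false ≤ j ≤ stepPair i true, that is, when
-- j is one of these two consecutive numbers.
mismatch : ℕ → ℕ → ℕ
mismatch i j = (stepPair i false ∸ j) + (j ∸ stepPair i true)

mismatchᵖ : PartRec 2
mismatchᵖ = comp addᵖ (comp monusᵖ (proj (suc zero) ∷ stepPairᵖ false ∷ []) ∷
                       comp monusᵖ (stepPairᵖ true ∷ proj (suc zero) ∷ []) ∷ [])

mismatchᵖ⇓ : ∀ i j → mismatchᵖ [ i ∷ j ∷ [] ]⇓ mismatch i j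
mismatchᵖ⇓ i j = comp⇓
  (comp⇓ (proj⇓ ∷ stepPairᵖ⇓ false i j ∷ []) (monusᵖ⇓ j (stepPair i false)) ∷
   comp⇓ (stepPairᵖ⇓ true i j ∷ proj⇓ ∷ []) (monusᵖ⇓ (stepPair i true) j) ∷ [])
  (addᵖ⇓ (stepPair i false ∸ j) (j ∸ stepPair i true))

mismatch-stepPair : ∀ i b → mismatch i (stepPair i b) ≡ 0
mismatch-stepPair i b = cong₂ _+_ (m≤n⇒m∸n≡0 (lower b)) (m≤n⇒m∸n≡0 (upper b))
  where
  false≤true : stepPair i false ≤ stepPair i true
  false≤true = ≤-trans (n≤1+n _) (≤-reflexive (sym (stepPair-suc i)))
  lower : ∀ b → stepPair i false ≤ stepPair i b
  lower false = ≤-refl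
  lower true  = false≤true
  upper : ∀ b → stepPair i b ≤ stepPair i true
  upper false = false≤true
  upper true  = ≤-refl

mismatch≡0⇒stepPair : ∀ i j → mismatch i j ≡ 0 → ∃[ b ] stepPair i b ≡ j
mismatch≡0⇒stepPair i j eq
  with lower ← m∸n≡0⇒m≤n {stepPair i false} {j} (m+n≡0⇒m≡0 _ eq)
     | upper ← m∸n≡0⇒m≤n {j} {stepPair i true} (m+n≡0⇒n≡0 (stepPair i false ∸ j) eq)
  with m≤n⇒m<n∨m≡n lower
... | inj₂ eq′ = false , eq′
... | inj₁ lt  = true , ≤-antisym (subst (_≤ j) (sym (stepPair-suc i)) lt) upper

-- The parity of `step i b` determines `b`.
step-injective : ∀ {i j} b c → step i b ≡ step j c → b ≡ c × i ≡ j
step-injective         false false eq = refl , *-cancelˡ-≡ _ _ 2 (suc-injective eq)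
step-injective {i} {j} false true  eq = contradiction (suc-injective eq) (even≢odd i j)
step-injective {i} {j} true  false eq = contradiction (sym (suc-injective eq)) (even≢odd j i)
step-injective         true  true  eq = refl , *-cancelˡ-≡ _ _ 2 (suc-injective (suc-injective eq))

stepPair-injective : ∀ {i j} b c → stepPair i b ≡ stepPair j c → i ≡ j
stepPair-injective b c eq = proj₂ (step-injective b c (proj₂ (step-injective (not b) (not c) eq)))

index-injective : ∀ {s t} → index s ≡ index t → s ≡ t
-- The outermost `step` of `index` reads the last bit, so the comparison runs over the reversed
-- strings.
index-injective {s} {t} eq = reverse-injective (foldr-injective (reverse s) (reverse t)
  (trans (reverse-foldr (flip step) 0 s) (trans eq (sym (reverse-foldr (flip step) 0 t)))))
  where
  foldr-injective : ∀ r q → foldr (flip step) 0 r ≡ foldr (flip step) 0 q → r ≡ q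
  foldr-injective []      []      _  = refl
  foldr-injective []      (c ∷ q) ()
  foldr-injective (b ∷ r) []      ()
  foldr-injective (b ∷ r) (c ∷ q) eq with step-injective b c eq
  ... | b≡c , eq′ = cong₂ _∷_ b≡c (foldr-injective r q eq′)

-- Diverges unless its argument has the form stepPair i b.
unpairᵖ : PartRec 1
unpairᵖ = mini mismatchᵖ

unpairᵖ⇓ : ∀ i b → unpairᵖ [ stepPair i b ∷ [] ]⇓ i
unpairᵖ⇓ i b = mini⇓ below
  (subst (mismatchᵖ [ i ∷ j ∷ [] ]⇓_) (mismatch-stepPair i b) (mismatchᵖ⇓ i j))
  where
  j = stepPair i b
  below : ∀ k → k < i → ∃[ v ] mismatchᵖ [ k ∷ j ∷ [] ]⇓ suc v
  below k k<i with mismatch k j in eq | mismatchᵖ⇓ k j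
  ... | suc v | d = v , d
  ... | zero  | _ with mismatch≡0⇒stepPair k j eq
  -- A zero at `k` would make `stepPair k c` equal to `stepPair i b`, forcing `k` to be `i`.
  ...   | c , eq′ = contradiction k<i (<-irrefl (stepPair-injective c b eq′))

unpairᵖ⇓⇒stepPair : ∀ {i j} → unpairᵖ [ j ∷ [] ]⇓ i → ∃[ b ] stepPair i b ≡ j
unpairᵖ⇓⇒stepPair {i} {j} (mini⇓ _ d) =
  mismatch≡0⇒stepPair i j (⇓-deterministic (mismatchᵖ⇓ i j) d)

unpairsᵖ : PartRec 2
unpairsᵖ = prim (proj zero) (comp unpairᵖ (proj (suc zero) ∷ []))

-- Pairs are stripped from the end of the string, so the last iteration removes the first pair; the
-- induction therefore moves that pair into the start value `i`.
unpairsᵖ⇓ : ∀ {n s} i → Pairs n s → unpairsᵖ [ n ∷ foldl step i s ∷ [] ]⇓ i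
unpairsᵖ⇓ i []          = prim-zero⇓ proj⇓
unpairsᵖ⇓ i (pair b ps) =
  prim-suc⇓ (unpairsᵖ⇓ (stepPair i b) ps) (comp⇓ (proj⇓ ∷ []) (unpairᵖ⇓ i b))

unpairsᵖ⇓⇒Pairs : ∀ n {i j} → unpairsᵖ [ n ∷ j ∷ [] ]⇓ i → ∃[ s ] (Pairs n s × foldl step i s ≡ j)
unpairsᵖ⇓⇒Pairs zero (prim-zero⇓ proj⇓) = [] , [] , refl
unpairsᵖ⇓⇒Pairs (suc n) (prim-suc⇓ d (comp⇓ (proj⇓ ∷ []) u))
  with b , refl ← unpairᵖ⇓⇒stepPair u
  with s , ps , eq ← unpairsᵖ⇓⇒Pairs n d = b ∷ not b ∷ s , pair b ps , eq

-- The minimisation variable is ignored: this halts iff unpairsᵖ returns 0.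
pairsᵖ : PartRec 2
pairsᵖ = mini (comp unpairsᵖ (proj (suc zero) ∷ proj (suc (suc zero)) ∷ []))

Pairs-uniformlyCE : UniformlyCE Pairs
Pairs-uniformlyCE = pairsᵖ , λ n s → mk⇔ halts (member n s)
  where
  halts : ∀ {n s} → Pairs n s → pairsᵖ [ n ∷ index s ∷ [] ]↓
  halts ps = 0 , mini⇓ (λ _ ()) (comp⇓ (proj⇓ ∷ proj⇓ ∷ []) (unpairsᵖ⇓ 0 ps))
  member : ∀ n s → pairsᵖ [ n ∷ index s ∷ [] ]↓ → Pairs n s
  member n s (_ , mini⇓ _ (comp⇓ (proj⇓ ∷ proj⇓ ∷ []) d)) with unpairsᵖ⇓⇒Pairs n d
  -- The result 0 is the index of the empty string, so `t` has the same index as `s`.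
  ... | t , ps , eq = subst (Pairs n) (index-injective eq) ps

Pairs-MLTest : MLTest Pairs
Pairs-MLTest = record { uniformlyCE = Pairs-uniformlyCE ; small = Pairs-small }

corollary5p2 : (F : Cantor → Cantor) → RandomOnline F → ¬ StrictlySurjective _≗_ F
corollary5p2 F (x , random , F≗online) onto =
  random Pairs Pairs-MLTest λ n → n * 2 , alternatingPairs⇒Pairs x alternating n
  where
  alternating : AlternatingPairs x
  -- `F` agrees with `online x` only pointwise, so its preimages are carried over bit by bit.
  alternating = onto⇒alternatingPairs x λ z →
    proj₁ (onto z) , λ k → trans (sym (F≗online (proj₁ (onto z)) k)) (proj₂ (onto z) k)
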